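{- Let $r$ be a non-negative integer, let $n\ge 1$, let $a=(a_1,\ldots,a_n)$ and $b=(b_1,\ldots,b_n)$ be two $n$-tuples of positive integers, and let $X$ be a non-empty subset of $\{r+1,\to\}$. The graph $\mathrm{G}(\mathcal{N}_r(a,b,X))$ is a tree with root $\{0,r+1,\to\}$. Moreover, the set of children of a vertex $S$ in $\mathrm{G}(\mathcal{N}_r(a,b,X))$ is $$\left\{ S\setminus\{m\} \mid m\in\mathrm{msg}(S),\; m>\mathrm{F}(S),\; \text{and}\; S\setminus\{m\}\in\mathcal{N}(a,b,X)\right\}.$$
   Context: $\mathbb{N}$ is the set of non-negative integers, $\{k,\to\}=\{m\in\mathbb{N}\mid m\ge k\}$ and $\{0,k,\to\}=\{0\}\cup\{k,\to\}$. A numerical semigroup is a submonoid $S$ of $(\mathbb{N},+)$ with $\mathbb{N}\setminus S$ finite; its Frobenius number $\mathrm{F}(S)$ is the maximum integer not belonging to $S$ (so $\mathrm{F}(\mathbb{N})=-1$). $\mathrm{msg}(S)$ denotes the (unique) minimal system of generators of $S$, i.e. $\mathrm{msg}(S)=(S\setminus\{0\})\setminus\big((S\setminus\{0\})+(S\setminus\{0\})\big)$. For $s\in\mathbb{N}$, $as+b=(a_1s+b_1,\ldots,a_ns+b_n)$. $\mathcal{N}(a,b,X)$ is the set of all numerical semigroups $S$ such that $X\subseteq S$ and $as+b\in S^n$ for all $s\in S\setminus\{0\}$, and $\mathcal{N}_r(a,b,X)=\{S\in\mathcal{N}(a,b,X)\mid S\subseteq\{0,r+1,\to\}\}$. A graph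 is a pair $(V,E)$ with $V$ a non-empty set (of vertices) and $E\subseteq\{(v,w)\in V\times V\mid v\neq w\}$ (edges). A path of length $k$ connecting vertices $x$ and $y$ is a sequence of different edges $(v_0,v_1),\ldots,(v_{k-1},v_k)$ with $v_0=x$ and $v_k=y$. A graph is a tree if there is a vertex $\rho$ (the root) such that for every other vertex $x$ there exists a unique path connecting $x$ and $\rho$. If $(x,y)$ is an edge of a tree, then $x$ is a child of $y$. The graph $\mathrm{G}(\mathcal{N}_r(a,b,X))$ has vertex set $\mathcal{N}_r(a,b,X)$, and $(S,S')\in\mathcal{N}_r(a,b,X)\times\mathcal{N}_r(a,b,X)$ is an edge if and only if $S'=S\cup\{\mathrm{F}(S)\}$. -}

module Defs where

open import Data.Empty using (⊥-elim)
open import Data.Integer.Base as ℤ using (ℤ; +_; -[1+_]; -1ℤ)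
import Data.Integer.Properties as ℤ
open import Data.List.Base using (List; []; _∷_; map; upTo; filter)
import Data.List.Extrema as Extrema
import Data.List.Membership.Propositional as List
open import Data.List.Membership.Propositional.Properties
  using (∈-map⁺; ∈-map⁻; ∈-filter⁺; ∈-filter⁻; ∈-upTo⁺; ∈-upTo⁻)
import Data.List.Relation.Binary.Equality.Setoid as ListEquality
import Data.List.Relation.Unary.All as ListAll
import Data.List.Relation.Unary.Unique.Setoid as ListUnique
open import Data.Nat.Base using (ℕ; zero; suc; _+_; _*_; _≤_; _<_; z≤n; s≤s; >-nonZero)
import Data.Nat.Properties as ℕ
open import Data.Product using (Σ-syntax; ∃; ∃₂; ∃!; _×_; _,_; proj₁; proj₂)
open import Data.Product.Relation.Binary.Pointwise.NonDependent using (×-setoid)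
open import Data.Sum.Base using (_⊎_; inj₁; inj₂)
open import Data.Vec.Functional using (Vector; zipWith)
open import Data.Vec.Functional.Relation.Unary.All using (All)
open import Function.Base using (_∘_)
open import Level using (Level; 0ℓ; _⊔_) renaming (suc to ℓsuc)
open import Relation.Binary.Bundles using (Setoid)
open import Relation.Binary.Core using (Rel)
open import Relation.Binary.Definitions using (_Respects₂_; Irreflexive)
import Relation.Binary.Construct.On as On
open import Relation.Binary.PropositionalEquality.Core using (_≡_; refl; sym; trans)
open import Relation.Nullary.Decidable.Core using (yes; no)
open import Relation.Nullary.Negation.Core using (¬_)
open import Relation.Unary using (Pred; _∈_; _∉_; _⊆_; _≐_; _∪_; _∖_; ∁; ｛_｝)
open import Relation.Unary.Relation.Binary.Equality using (≐-setoid)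

private
  variable
    c ℓ e : Level
    n : ℕ

------------------------------------------------------------------------
-- Graphs and trees

record Graph c ℓ e : Set (ℓsuc (c ⊔ ℓ ⊔ e)) where
  field
    vertices   : Setoid c ℓ
  open Setoid vertices public renaming (Carrier to Vertex) using (_≈_)
  field
    inhabited  : Vertex
    Edge       : Rel Vertex e
    edge-resp  : Edge Respects₂ _≈_
    edge-irrefl : Irreflexive _≈_ Edge

  Pairs : Setoid c ℓ
  Pairs = ×-setoid vertices vertices

  open ListEquality Pairs public using (_≋_)
  open ListUnique Pairs public using (Unique)

  -- Walk x ps y: the list ps has the form (v₀ , v₁) , … , (vₖ₋₁ , vₖ) with
  -- v₀ = x and vₖ = y, and all its members are edges.  All equalities
  -- between vertices are taken in the setoid.
  data Walk (x : Vertex) : List (Vertex × Vertex) → Vertex → Set (c ⊔ ℓ ⊔ e) where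
    nil  : ∀ {y} → x ≈ y → Walk x [] y
    cons : ∀ {v w y ps} → x ≈ v → Edge v w → Walk w ps y → Walk x ((v , w) ∷ ps) y

  IsPath : Vertex → Vertex → Pred (List (Vertex × Vertex)) (c ⊔ ℓ ⊔ e)
  IsPath x y ps = Walk x ps y × Unique ps

  IsTreeWithRoot : Pred Vertex (c ⊔ ℓ ⊔ e)
  IsTreeWithRoot ρ = ∀ x → ¬ (x ≈ ρ) → ∃! _≋_ (IsPath x ρ)

  _IsChildOf_ : Rel Vertex e
  x IsChildOf y = Edge x y

------------------------------------------------------------------------
-- Subsets of ℕ

infix 10 ｛_,→｝ ｛0,_,→｝

｛_,→｝ : ℕ → Pred ℕ 0ℓ
｛ k ,→｝ = k ≤_

｛0,_,→｝ : ℕ → Pred ℕ 0ℓ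
｛0, k ,→｝ = ｛ 0 ｝ ∪ ｛ k ,→｝

infixl 7 _⊕_

_⊕_ : Pred ℕ 0ℓ → Pred ℕ 0ℓ → Pred ℕ 0ℓ
(A ⊕ B) z = ∃₂ λ x y → x ∈ A × y ∈ B × z ≡ x + y

-- The same set, as a subset of ℤ.
⟦_⟧ : Pred ℕ 0ℓ → Pred ℤ 0ℓ
⟦ S ⟧ z = ∃ λ k → k ∈ S × z ≡ + k

------------------------------------------------------------------------
-- Numerical semigroups

-- ℕ ∖ S is finite when S is the complement of a finite list of gaps.
-- Classically this is the same as asking that ∁ S be listed by gaps;
-- constructively, this form also makes membership in S decidable.
record IsNumericalSemigroup (S : Pred ℕ 0ℓ) : Set where
  field
    0∈       : 0 ∈ S
    +-closed : ∀ {x y} → x ∈ S → y ∈ S → x + y ∈ S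
    cofinite : ∃ λ (gaps : List ℕ) → S ≐ ∁ (List._∈ gaps)

IsFrobeniusNumber : Pred ℕ 0ℓ → Pred ℤ 0ℓ
IsFrobeniusNumber S f = f ∉ ⟦ S ⟧ × (∀ z → z ∉ ⟦ S ⟧ → z ℤ.≤ f)

frobenius : ∀ {S} → IsNumericalSemigroup S → ∃ (IsFrobeniusNumber S)
frobenius {S} isNS = f , f∉ (argmax-sel (λ z → z) -1ℤ gapsℤ) , f-max
  where
  open Extrema ℤ.≤-totalOrder using (max; argmax-sel; xs≤max; ⊥≤max)
  open IsNumericalSemigroup isNS
  gaps = proj₁ cofinite
  S≐   = proj₂ cofinite
  gapsℤ = map +_ gaps

  f : ℤ
  f = max -1ℤ gapsℤ

  f∉ : ∀ {z} → z ≡ -1ℤ ⊎ z List.∈ gapsℤ → z ∉ ⟦ S ⟧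
  f∉ (inj₁ refl) (_ , _ , ())
  f∉ (inj₂ z∈) (k , k∈S , refl) with ∈-map⁻ +_ z∈
  ... | _ , k∈gaps , refl = proj₁ S≐ k∈S k∈gaps

  f-max : ∀ z → z ∉ ⟦ S ⟧ → z ℤ.≤ f
  f-max -[1+ k ] _ = ℤ.≤-trans (ℤ.-≤- z≤n) (⊥≤max -1ℤ gapsℤ)
  f-max (+ k) k∉ with k ∈? gaps
    where open import Data.List.Membership.DecPropositional ℕ._≟_ using (_∈?_)
  ... | yes k∈gaps = ListAll.lookup (xs≤max -1ℤ gapsℤ) (∈-map⁺ +_ k∈gaps)
  ... | no  k∉gaps = ⊥-elim (k∉ (k , proj₂ S≐ k∉gaps , refl))

F : ∀ {S} → IsNumericalSemigroup S → ℤ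
F isNS = proj₁ (frobenius isNS)

msg : Pred ℕ 0ℓ → Pred ℕ 0ℓ
msg S = (S ∖ ｛ 0 ｝) ∖ ((S ∖ ｛ 0 ｝) ⊕ (S ∖ ｛ 0 ｝))

------------------------------------------------------------------------
-- The families 𝒩(a,b,X) and 𝒩ᵣ(a,b,X)

_·_⊞_ : Vector ℕ n → ℕ → Vector ℕ n → Vector ℕ n
a · s ⊞ b = zipWith (λ aᵢ bᵢ → aᵢ * s + bᵢ) a b

𝒩 : (a b : Vector ℕ n) (X : Pred ℕ 0ℓ) → Pred (Pred ℕ 0ℓ) 0ℓ
𝒩 a b X S = IsNumericalSemigroup S
          × X ⊆ S
          × (∀ s → s ∈ S ∖ ｛ 0 ｝ → All (_∈ S) (a · s ⊞ b))

𝒩ᵣ : (r : ℕ) (a b : Vector ℕ n) (X : Pred ℕ 0ℓ) → Pred (Pred ℕ 0ℓ) 0ℓ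
𝒩ᵣ r a b X S = S ∈ 𝒩 a b X × S ⊆ ｛0, suc r ,→｝

------------------------------------------------------------------------
-- The graph G(𝒩ᵣ(a,b,X))

half-line : ∀ r → IsNumericalSemigroup ｛0, suc r ,→｝
half-line r = record
  { 0∈       = inj₁ refl
  ; +-closed = closed
  ; cofinite = gaps , (λ k∈ k∈gaps → sound k∈ (∈-filter⁻ (0 ℕ.<?_) k∈gaps)) , complete _
  }
  where
  closed : ∀ {x y} → x ∈ ｛0, suc r ,→｝ → y ∈ ｛0, suc r ,→｝ → x + y ∈ ｛0, suc r ,→｝
  closed (inj₁ refl) y∈ = y∈
  closed (inj₂ r<x)  _  = inj₂ (ℕ.≤-trans r<x (ℕ.m≤m+n _ _))

  gaps : List ℕ
  gaps = filter (0 ℕ.<?_) (upTo (suc r))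

  sound : ∀ {k} → k ∈ ｛0, suc r ,→｝ → ¬ (k List.∈ upTo (suc r) × 0 < k)
  sound (inj₁ refl) (_ , ())
  sound (inj₂ r<k) (k∈ , _) = ℕ.<⇒≱ (∈-upTo⁻ k∈) r<k

  complete : ∀ k → ¬ (k List.∈ gaps) → k ∈ ｛0, suc r ,→｝
  complete zero    _  = inj₁ refl
  complete (suc k) k∉ with suc k ℕ.<? suc r
  ... | yes k<r = ⊥-elim (k∉ (∈-filter⁺ (0 ℕ.<?_) (∈-upTo⁺ k<r) (s≤s z≤n)))
  ... | no  k≮r = inj₂ (ℕ.≮⇒≥ k≮r)

module _ (r : ℕ) (a b : Vector ℕ n) (X : Pred ℕ 0ℓ)
         (a>0 : All (0 <_) a) (X⊆ : X ⊆ ｛ suc r ,→｝) where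

  half-line∈𝒩ᵣ : ｛0, suc r ,→｝ ∈ 𝒩ᵣ r a b X
  half-line∈𝒩ᵣ = (half-line r , inj₂ ∘ X⊆ , step) , λ k∈ → k∈
    where
    step : ∀ s → s ∈ ｛0, suc r ,→｝ ∖ ｛ 0 ｝ → All (_∈ ｛0, suc r ,→｝) (a · s ⊞ b)
    step s (inj₁ 0≡s , 0≢s) i = ⊥-elim (0≢s 0≡s)
    step s (inj₂ r<s , _)   i = inj₂ (ℕ.≤-trans r<s
      (ℕ.≤-trans (ℕ.m≤n*m s (a i) {{>-nonZero (a>0 i)}}) (ℕ.m≤m+n _ (b i))))

  G : Graph (ℓsuc 0ℓ) 0ℓ 0ℓ
  G = record
    { vertices    = On.setoid (≐-setoid ℕ 0ℓ) set
    ; inhabited   = _ , half-line∈𝒩ᵣ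
    ; Edge        = E
    ; edge-resp   = (λ {x} {y} {z} → resp₁ {x} {y} {z}) , (λ {x} {y} {z} → resp₂ {x} {y} {z})
    ; edge-irrefl = λ {x} {y} → irrefl {x} {y}
    }
    where
    V : Set₁
    V = Σ[ S ∈ Pred ℕ 0ℓ ] S ∈ 𝒩ᵣ r a b X

    set : V → Pred ℕ 0ℓ
    set = proj₁

    FV : V → ℤ
    FV (_ , (isNS , _) , _) = F isNS

    -- The union is taken in ℤ because F ℕ = -1: thus ℕ has no outgoing edge.
    E : Rel V 0ℓ
    E v w = ⟦ set w ⟧ ≐ ⟦ set v ⟧ ∪ ｛ FV v ｝

    ⟦⟧-mono : ∀ {A B} → A ⊆ B → ⟦ A ⟧ ⊆ ⟦ B ⟧
    ⟦⟧-mono A⊆B (k , k∈A , z≡k) = k , A⊆B k∈A , z≡k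

    FV∉ : ∀ v → FV v ∉ ⟦ set v ⟧
    FV∉ (_ , (isNS , _) , _) = proj₁ (proj₂ (frobenius isNS))

    FV-max : ∀ v z → z ∉ ⟦ set v ⟧ → z ℤ.≤ FV v
    FV-max (_ , (isNS , _) , _) = proj₂ (proj₂ (frobenius isNS))

    FV-cong : ∀ v w → set v ≐ set w → FV v ≡ FV w
    FV-cong v w (v⊆w , w⊆v) = ℤ.≤-antisym
      (FV-max w (FV v) (FV∉ v ∘ ⟦⟧-mono w⊆v))
      (FV-max v (FV w) (FV∉ w ∘ ⟦⟧-mono v⊆w))

    resp₁ : ∀ {v w w′} → set w ≐ set w′ → E v w → E v w′
    resp₁ (w⊆w′ , w′⊆w) (⊆∪ , ∪⊆) = ⊆∪ ∘ ⟦⟧-mono w′⊆w , ⟦⟧-mono w⊆w′ ∘ ∪⊆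

    resp₂ : ∀ {w v v′} → set v ≐ set v′ → E v w → E v′ w
    resp₂ {w} {v} {v′} v≐v′@(v⊆v′ , v′⊆v) (⊆∪ , ∪⊆) = to ∘ ⊆∪ , ∪⊆ ∘ from
      where
      to : ⟦ set v ⟧ ∪ ｛ FV v ｝ ⊆ ⟦ set v′ ⟧ ∪ ｛ FV v′ ｝
      to (inj₁ z∈)  = inj₁ (⟦⟧-mono v⊆v′ z∈)
      to (inj₂ F≡z) = inj₂ (trans (sym (FV-cong v v′ v≐v′)) F≡z)
      from : ⟦ set v′ ⟧ ∪ ｛ FV v′ ｝ ⊆ ⟦ set v ⟧ ∪ ｛ FV v ｝
      from (inj₁ z∈)  = inj₁ (⟦⟧-mono v′⊆v z∈)
      from (inj₂ F≡z) = inj₂ (trans (FV-cong v v′ v≐v′) F≡z)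

    irrefl : ∀ {v w} → set v ≐ set w → ¬ E v w
    irrefl {v} (_ , w⊆v) (_ , ∪⊆) = FV∉ v (⟦⟧-mono w⊆v (∪⊆ (inj₂ refl)))

{-# OPTIONS --safe #-}

-- Along an edge the Frobenius number drops strictly, each vertex has at most
-- one outgoing edge and the root has none; so all walks to the root from a
-- given vertex agree, and they never repeat an edge.  A vertex S with
-- F(S) > r has the parent S ∪ {F(S)}, as aᵢ F(S) + bᵢ > F(S) is in S; one with
-- F(S) ≤ r is the root.

module Submission where

open import Defs
open import Data.Empty using (⊥-elim)
open import Data.Integer.Base as ℤ using (ℤ; +_; -[1+_])
import Data.Integer.Properties as ℤ
open import Data.List.Base using (List; []; _∷_; filter)
import Data.List.Membership.Propositional as List
open import Data.List.Membership.Propositional.Properties using (∈-filter⁺; ∈-filter⁻)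
open import Data.List.Relation.Binary.Pointwise.Base using ([]; _∷_)
open import Data.List.Relation.Unary.All as ListAll using ([]; _∷_)
open import Data.List.Relation.Unary.AllPairs using ([]; _∷_)
open import Data.Nat.Base using (ℕ; zero; suc; _+_; _≤_; _<_; z<s; >-nonZero)
import Data.Nat.Properties as ℕ
open import Data.Product.Base using (∃; _×_; _,_; proj₁; proj₂)
open import Data.Sum.Base using (inj₁; inj₂; [_,_]′)
open import Data.Vec.Functional using (Vector)
open import Data.Vec.Functional.Relation.Unary.All using (All)
open import Function.Base using (_∘_)
open import Level using (0ℓ)
open import Relation.Binary.PropositionalEquality using (_≡_; refl; sym; subst)
open import Relation.Nullary.Decidable.Core using (yes; no; ¬?)
open import Relation.Nullary.Negation.Core using (¬_)
open import Relation.Unary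
  using (Pred; Satisfiable; _∈_; _∉_; _⊆_; _≐_; _∪_; _∖_; ∁; ｛_｝)
open import Relation.Unary.Properties using (≐-sym; ≐-trans)

private
  variable
    S T : Pred ℕ 0ℓ
    f g : ℤ
    k n : ℕ

-- Subsets of ℕ inside ℤ, and Frobenius numbers

⟦⟧-mono : S ⊆ T → ⟦ S ⟧ ⊆ ⟦ T ⟧
⟦⟧-mono S⊆T (k , k∈S , z≡k) = k , S⊆T k∈S , z≡k

⟦⟧⁺ : k ∈ S → + k ∈ ⟦ S ⟧
⟦⟧⁺ k∈S = _ , k∈S , refl

⟦⟧⁻ : + k ∈ ⟦ S ⟧ → k ∈ S
⟦⟧⁻ (_ , k∈S , refl) = k∈S

⟦⟧-cancel : ⟦ S ⟧ ≐ ⟦ T ⟧ → S ≐ T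
⟦⟧-cancel (⊆ , ⊇) = (λ x → ⟦⟧⁻ (⊆ (⟦⟧⁺ x))) , (λ x → ⟦⟧⁻ (⊇ (⟦⟧⁺ x)))

-- Being in `S` amounts to not being in the list of gaps, and negations are stable. This turns the
-- maximality of the Frobenius number, a statement about non-members, into membership.
∈-stable : IsNumericalSemigroup S → ¬ (k ∉ S) → k ∈ S
∈-stable isNS ¬k∉S = proj₂ S≐ (λ k∈gaps → ¬k∉S (λ k∈S → proj₁ S≐ k∈S k∈gaps))
  where S≐ = proj₂ (IsNumericalSemigroup.cofinite isNS)

isNumericalSemigroup-resp-≐ : S ≐ T → IsNumericalSemigroup S → IsNumericalSemigroup T
isNumericalSemigroup-resp-≐ S≐T@(S⊆T , T⊆S) isNS = record
  { 0∈       = S⊆T 0∈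
  ; +-closed = λ x∈ y∈ → S⊆T (+-closed (T⊆S x∈) (T⊆S y∈))
  ; cofinite = proj₁ cofinite , ≐-trans (≐-sym S≐T) (proj₂ cofinite)
  }
  where open IsNumericalSemigroup isNS

F-isFrobeniusNumber : (isNS : IsNumericalSemigroup S) → IsFrobeniusNumber S (F isNS)
F-isFrobeniusNumber isNS = proj₂ (frobenius isNS)

frobenius-antitone : IsFrobeniusNumber S f → IsFrobeniusNumber T g → S ⊆ T → g ℤ.≤ f
frobenius-antitone (_ , max) (g∉ , _) S⊆T = max _ (g∉ ∘ ⟦⟧-mono S⊆T)

frobenius-cong : IsFrobeniusNumber S f → IsFrobeniusNumber T g → S ≐ T → f ≡ g
frobenius-cong Ff Fg (S⊆T , T⊆S) =
  ℤ.≤-antisym (frobenius-antitone Fg Ff T⊆S) (frobenius-antitone Ff Fg S⊆T)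

>frobenius⇒∈ : IsNumericalSemigroup S → IsFrobeniusNumber S f → f ℤ.< + k → k ∈ S
>frobenius⇒∈ isNS (_ , max) f<k =
  ∈-stable isNS (λ k∉S → ℤ.<⇒≱ f<k (max _ (k∉S ∘ ⟦⟧⁻)))

-- A sum with `k` as a summand is `k` itself or exceeds `k`, and everything above the Frobenius
-- number is already in `S`.
adjoin-frobenius : IsNumericalSemigroup S → IsFrobeniusNumber S (+ k) →
                   IsNumericalSemigroup (S ∪ ｛ k ｝)
adjoin-frobenius {S} {k} isNS isF = record
  { 0∈       = inj₁ 0∈
  ; +-closed = closed
  ; cofinite = gaps′ , sound , complete
  }
  where
  open IsNumericalSemigroup isNS
  gaps = proj₁ cofinite
  S≐   = proj₂ cofinite
  ≢k?  = λ m → ¬? (k ℕ.≟ m)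
  gaps′ = filter ≢k? gaps

  k+m∈ : ∀ m → k + m ∈ S ∪ ｛ k ｝
  k+m∈ zero    = inj₂ (sym (ℕ.+-identityʳ k))
  k+m∈ (suc m) = inj₁ (>frobenius⇒∈ isNS isF (ℤ.+<+ (ℕ.m<m+n k z<s)))

  closed : ∀ {x y} → x ∈ S ∪ ｛ k ｝ → y ∈ S ∪ ｛ k ｝ → x + y ∈ S ∪ ｛ k ｝
  closed (inj₁ x∈)       (inj₁ y∈)   = inj₁ (+-closed x∈ y∈)
  closed {x} (inj₁ x∈)   (inj₂ refl) = subst (S ∪ ｛ k ｝) (ℕ.+-comm k x) (k+m∈ x)
  closed {y = y} (inj₂ refl) _       = k+m∈ y

  sound : S ∪ ｛ k ｝ ⊆ ∁ (List._∈ gaps′)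
  sound (inj₁ x∈)  x∈gaps = proj₁ S≐ x∈ (proj₁ (∈-filter⁻ ≢k? x∈gaps))
  sound (inj₂ k≡x) x∈gaps = proj₂ (∈-filter⁻ ≢k? {xs = gaps} x∈gaps) k≡x

  complete : ∁ (List._∈ gaps′) ⊆ S ∪ ｛ k ｝
  complete {x} x∉ with k ℕ.≟ x
  ... | yes k≡x = inj₂ k≡x
  ... | no  k≢x = inj₁ (proj₂ S≐ (λ x∈gaps → x∉ (∈-filter⁺ ≢k? x∈gaps k≢x)))

⟦∪⟧ : ⟦ S ∪ ｛ k ｝ ⟧ ≐ ⟦ S ⟧ ∪ ｛ + k ｝
⟦∪⟧ = (λ { (m , inj₁ m∈S , z≡m)   → inj₁ (m , m∈S , z≡m)
         ; (m , inj₂ refl , refl) → inj₂ refl })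
    , (λ { (inj₁ z∈)   → ⟦⟧-mono inj₁ z∈
         ; (inj₂ refl) → ⟦⟧⁺ (inj₂ refl) })

𝒩-resp-≐ : (a b : Vector ℕ n) {X : Pred ℕ 0ℓ} → S ≐ T → S ∈ 𝒩 a b X → T ∈ 𝒩 a b X
𝒩-resp-≐ _ _ S≐T@(S⊆T , T⊆S) (isNS , X⊆S , step) =
  isNumericalSemigroup-resp-≐ S≐T isNS ,
  S⊆T ∘ X⊆S ,
  λ { s (s∈T , s≢0) i → S⊆T (step s (T⊆S s∈T , s≢0) i) }

-- Adjoining and removing one element

module _ (isF : IsFrobeniusNumber S f) (edge : ⟦ T ⟧ ≐ ⟦ S ⟧ ∪ ｛ f ｝) where

  edge-⊆ : S ⊆ T
  edge-⊆ k∈S = ⟦⟧⁻ (proj₂ edge (inj₁ (⟦⟧⁺ k∈S)))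

  -- Enlarging a set cannot raise its Frobenius number, and equality is excluded because `f` now
  -- belongs to `T`.
  edge-frobenius-< : IsFrobeniusNumber T g → g ℤ.< f
  edge-frobenius-< isG@(g∉T , _) =
    ℤ.≤∧≢⇒< (frobenius-antitone isF isG edge-⊆) (λ { refl → g∉T (proj₂ edge (inj₂ refl)) })

edge-functional : ∀ {S′ T′} → S ≐ S′ → f ≡ g →
                  ⟦ T ⟧ ≐ ⟦ S ⟧ ∪ ｛ f ｝ → ⟦ T′ ⟧ ≐ ⟦ S′ ⟧ ∪ ｛ g ｝ → T ≐ T′
edge-functional (S⊆S′ , S′⊆S) refl (to , from) (to′ , from′) = ⟦⟧-cancel
  ( from′ ∘ [ inj₁ ∘ ⟦⟧-mono S⊆S′ , inj₂ ]′ ∘ to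
  , from ∘ [ inj₁ ∘ ⟦⟧-mono S′⊆S , inj₂ ]′ ∘ to′ )

module _ {m : ℕ} (S-isNS : IsNumericalSemigroup S) (T-isNS : IsNumericalSemigroup T)
         (T-isF : IsFrobeniusNumber T (+ m)) (edge : ⟦ S ⟧ ≐ ⟦ T ⟧ ∪ ｛ + m ｝) where

  private
    m∈S : m ∈ S
    m∈S = ⟦⟧⁻ (proj₂ edge (inj₂ refl))

    m∉T : m ∉ T
    m∉T = proj₁ T-isF ∘ ⟦⟧⁺

  edge-∖ : T ≐ S ∖ ｛ m ｝
  edge-∖ = (λ x∈T → edge-⊆ T-isF edge x∈T , λ { refl → m∉T x∈T })
         , (λ { (x∈S , m≢x) → [ ⟦⟧⁻ , (λ { refl → ⊥-elim (m≢x refl) }) ]′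
                                (proj₁ edge (⟦⟧⁺ x∈S)) })

  -- If `m = x + y` with nonzero `x` and `y` in `S`, neither summand equals `m`, so both survive in
  -- `T`; closure of `T` would then put `m` in `T`.
  edge-msg : m ∈ msg S
  edge-msg = (m∈S , λ { refl → m∉T (IsNumericalSemigroup.0∈ T-isNS) }) , irreducible
    where
    irreducible : m ∉ (S ∖ ｛ 0 ｝) ⊕ (S ∖ ｛ 0 ｝)
    irreducible (x , y , (x∈S , 0≢x) , (y∈S , 0≢y) , refl) =
      m∉T (IsNumericalSemigroup.+-closed T-isNS
        (proj₂ edge-∖ (x∈S , λ x+y≡x →
          0≢y (ℕ.+-cancelˡ-≡ x 0 y (subst (_≡ x + y) (sym (ℕ.+-identityʳ x)) (sym x+y≡x)))))
        (proj₂ edge-∖ (y∈S , λ x+y≡y → 0≢x (ℕ.+-cancelʳ-≡ y 0 x (sym x+y≡y)))))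

-- A missing `z` above `m` would differ from `m`, hence be missing from `S` too, although it exceeds
-- `f`.
∖-isFrobeniusNumber : {m : ℕ} → IsFrobeniusNumber S f → f ℤ.< + m →
                      T ≐ S ∖ ｛ m ｝ → IsFrobeniusNumber T (+ m)
∖-isFrobeniusNumber (_ , max) f<m (T⊆ , ⊆T) =
  (λ m∈T → proj₂ (T⊆ (⟦⟧⁻ m∈T)) refl) ,
  λ z z∉T → ℤ.≮⇒≥ (λ m<z →
    ℤ.<⇒≱ (ℤ.<-trans f<m m<z)
      (max z (λ { (k , k∈S , refl) → z∉T (⟦⟧⁺ (⊆T (k∈S , λ { refl → ℤ.<-irrefl refl m<z }))) })))

∖-edge : {m : ℕ} → m ∈ S → T ≐ S ∖ ｛ m ｝ → ⟦ S ⟧ ≐ ⟦ T ⟧ ∪ ｛ + m ｝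
∖-edge {S} {T} {m} m∈S (T⊆ , ⊆T) = to , [ ⟦⟧-mono (proj₁ ∘ T⊆) , (λ { refl → ⟦⟧⁺ m∈S }) ]′
  where
  to : ⟦ S ⟧ ⊆ ⟦ T ⟧ ∪ ｛ + m ｝
  to (k , k∈S , refl) with m ℕ.≟ k
  ... | yes refl = inj₂ refl
  ... | no  m≢k  = inj₁ (⟦⟧⁺ (⊆T (k∈S , m≢k)))

-- The tree structure

module _ (r : ℕ) {n : ℕ} (a b : Vector ℕ n) (X : Pred ℕ 0ℓ)
         (a>0 : All (0 <_) a) (X⊆ : X ⊆ ｛ suc r ,→｝) where

  open Graph (G r a b X a>0 X⊆)

  private
    ρ : Vertex
    ρ = ｛0, suc r ,→｝ , half-line∈𝒩ᵣ r a b X a>0 X⊆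

    FV : Vertex → ℤ
    FV (_ , (isNS , _) , _) = F isNS

    FV-isF : ∀ v → IsFrobeniusNumber (proj₁ v) (FV v)
    FV-isF (_ , (isNS , _) , _) = F-isFrobeniusNumber isNS

  parent : All (0 <_) b → ∀ v → FV v ≡ + k → r < k → ∃ (Edge v)
  parent {k} b>0 v@(S , (isNS , X⊆S , step) , S⊆) F≡k r<k =
    ( S ∪ ｛ k ｝
    , ( adjoin-frobenius isNS isF
      , inj₁ ∘ X⊆S
      , λ { s (inj₁ s∈S , s≢0) i  → inj₁ (step s (s∈S , s≢0) i)
          ; s (inj₂ refl , s≢0) i → inj₁ (>frobenius⇒∈ isNS isF (ℤ.+<+ (k<ak+b i))) } )
    -- Here `r < k` keeps the enlarged semigroup inside the root.
    , [ S⊆ , (λ { refl → inj₂ r<k }) ]′ )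
    , subst (λ z → ⟦ S ∪ ｛ k ｝ ⟧ ≐ ⟦ S ⟧ ∪ ｛ z ｝) (sym F≡k) ⟦∪⟧
    where
    isF : IsFrobeniusNumber S (+ k)
    isF = subst (IsFrobeniusNumber S) F≡k (FV-isF v)

    k<ak+b : ∀ i → k < (a · k ⊞ b) i
    k<ak+b i = ℕ.≤-<-trans (ℕ.m≤n*m k (a i) {{>-nonZero (a>0 i)}}) (ℕ.m<m+n _ (b>0 i))

  ≤r⇒≈ρ : ∀ v → FV v ℤ.< + suc r → v ≈ ρ
  ≤r⇒≈ρ v@(_ , (isNS , _) , S⊆) F<r+1 = S⊆ ,
    [ (λ { refl → IsNumericalSemigroup.0∈ isNS })
    , (λ r<k → >frobenius⇒∈ isNS (FV-isF v) (ℤ.<-≤-trans F<r+1 (ℤ.+≤+ r<k))) ]′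

  -- Induction on a strict upper bound `N` for the Frobenius number: passing to the parent lowers
  -- that number, so the bound can drop by one.
  walk-to-ρ : All (0 <_) b → ∀ N v → FV v ℤ.< + N → ∃ λ ps → Walk v ps ρ
  walk-to-ρ b>0 zero v F<0 = [] , nil (≤r⇒≈ρ v (ℤ.<-trans F<0 (ℤ.+<+ z<s)))
  walk-to-ρ b>0 (suc N) v F≤N with FV v ℤ.<? + suc r
  ... | yes F<r+1 = [] , nil (≤r⇒≈ρ v F<r+1)
  -- Being at least `r + 1`, the Frobenius number is a natural number `k`, so it can be adjoined;
  -- the negative case is impossible.
  ... | no  F≮r+1 with FV v in F≡ | ℤ.≮⇒≥ F≮r+1
  ...   | + k | ℤ.+≤+ r<k =
    let w , e   = parent b>0 v F≡ r<k
        Fw<k    = subst (FV w ℤ.<_) F≡ (edge-frobenius-< (FV-isF v) e (FV-isF w))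
        ps , wk = walk-to-ρ b>0 N w (ℤ.<-≤-trans Fw<k (ℤ.+≤+ (ℕ.≤-pred (ℤ.drop‿+<+ F≤N))))
    in (v , w) ∷ ps , cons {v = v} {w} ((λ z → z) , (λ z → z)) e wk

  -- The target of an edge contains the Frobenius number of its source, but as a vertex it lies
  -- inside the root, which is the source here.
  ρ-sink : ∀ v w → v ≈ ρ → ¬ Edge v w
  ρ-sink v w@(_ , _ , w⊆ρ) (_ , ρ⊆v) (_ , ∪⊆w) =
    proj₁ (FV-isF v) (⟦⟧-mono (ρ⊆v ∘ w⊆ρ) (∪⊆w (inj₂ refl)))

  FV-cong : ∀ v w → v ≈ w → FV v ≡ FV w
  FV-cong v w = frobenius-cong (FV-isF v) (FV-isF w)

  walk-sources-≤ : ∀ {x y ps} → Walk x ps y → ListAll.All (λ p → FV (proj₁ p) ℤ.≤ FV x) ps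
  walk-sources-≤ (nil _) = []
  walk-sources-≤ {x} (cons {v} {w} x≈v e wk) =
    v≤x ∷ ListAll.map (λ u≤w → ℤ.≤-trans u≤w (ℤ.≤-trans (ℤ.<⇒≤ w<v) v≤x)) (walk-sources-≤ wk)
    where
    v≤x = ℤ.≤-reflexive (sym (FV-cong x v x≈v))
    w<v = edge-frobenius-< (FV-isF v) e (FV-isF w)

  -- All edges after `(v , w)` start at vertices whose Frobenius number is at most that of `w`,
  -- hence below that of `v`; so none of them equals `(v , w)`, even up to `_≈_`.
  walk-unique : ∀ {x y ps} → Walk x ps y → Unique ps
  walk-unique (nil _) = []
  walk-unique (cons {v} {w} _ e wk) =
    ListAll.map (λ {p} u≤w v,w≈p → ℤ.<⇒≱ (edge-frobenius-< (FV-isF v) e (FV-isF w))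
      (subst (ℤ._≤ FV w) (sym (FV-cong v (proj₁ p) (proj₁ v,w≈p))) u≤w)) (walk-sources-≤ wk)
    ∷ walk-unique wk

  -- Equal vertices have equal parents, so the walks agree edge by edge, and neither can stop first
  -- since no edge leaves the root. The starts are related only by `_≈_` because consecutive edges
  -- of a walk meet only up to `_≈_`.
  walk-to-ρ-≋ : ∀ {x x′ ps qs} → x ≈ x′ → Walk x ps ρ → Walk x′ qs ρ → ps ≋ qs
  walk-to-ρ-≋ _ (nil _) (nil _) = []
  walk-to-ρ-≋ x≈x′ (nil x≈ρ) (cons {v} {w} x′≈v e _) =
    ⊥-elim (ρ-sink v w (≐-trans (≐-sym (≐-trans x≈x′ x′≈v)) x≈ρ) e)
  walk-to-ρ-≋ x≈x′ (cons {v} {w} x≈v e _) (nil x′≈ρ) =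
    ⊥-elim (ρ-sink v w (≐-trans (≐-sym x≈v) (≐-trans x≈x′ x′≈ρ)) e)
  walk-to-ρ-≋ x≈x′ (cons {v} {w} x≈v e wk) (cons {v′} {w′} x′≈v′ e′ wk′) =
    (v≈v′ , w≈w′) ∷ walk-to-ρ-≋ w≈w′ wk wk′
    where
    v≈v′ = ≐-trans (≐-sym x≈v) (≐-trans x≈x′ x′≈v′)
    w≈w′ = edge-functional v≈v′ (FV-cong v v′ v≈v′) e e′

  isTree : All (0 <_) b → IsTreeWithRoot ρ
  isTree b>0 x _ =
    -- The absolute value makes the bound a natural number, also when the Frobenius number is -1.
    let ps , wk = walk-to-ρ b>0 (suc ℤ.∣ FV x ∣) x (i<1+∣i∣ (FV x))
    in ps , (wk , walk-unique wk) ,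
       λ { (wk′ , _) → walk-to-ρ-≋ {x} {x} ((λ z → z) , (λ z → z)) wk wk′ }
    where
    i<1+∣i∣ : ∀ i → i ℤ.< + suc ℤ.∣ i ∣
    i<1+∣i∣ (+ k)    = ℤ.+<+ (ℕ.n<1+n k)
    i<1+∣i∣ -[1+ k ] = ℤ.-<+

  -- The children of a vertex

  child⇒∖ : ∀ v w → v IsChildOf w →
            ∃ λ m → m ∈ msg (proj₁ w) × FV w ℤ.< + m × proj₁ w ∖ ｛ m ｝ ∈ 𝒩 a b X
                    × proj₁ v ≐ proj₁ w ∖ ｛ m ｝
  -- The Frobenius number of the child lies in the parent, so it is a natural number; this is the
  -- removed generator `m`.
  child⇒∖ v@(_ , v∈𝒩@(v-isNS , _) , _) w@(_ , (w-isNS , _) , _) e with proj₂ e (inj₂ refl)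
  ... | m , _ , F≡m =
    m , edge-msg w-isNS v-isNS isF e′
      , subst (FV w ℤ.<_) F≡m (edge-frobenius-< (FV-isF v) e (FV-isF w))
      , 𝒩-resp-≐ a b v≐ v∈𝒩 , v≐
    where
    isF = subst (IsFrobeniusNumber (proj₁ v)) F≡m (FV-isF v)
    e′  = subst (λ z → ⟦ proj₁ w ⟧ ≐ ⟦ proj₁ v ⟧ ∪ ｛ z ｝) F≡m e
    v≐  = edge-∖ w-isNS v-isNS isF e′

  ∖⇒child : ∀ w {m} → m ∈ msg (proj₁ w) → FV w ℤ.< + m → proj₁ w ∖ ｛ m ｝ ∈ 𝒩 a b X →
            T ≐ proj₁ w ∖ ｛ m ｝ → ∃ λ (T∈ : T ∈ 𝒩ᵣ r a b X) → (T , T∈) IsChildOf w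
  ∖⇒child {T} w@(S , _ , S⊆) {m} ((m∈S , _) , _) F<m ∖∈𝒩 T≐ =
    T∈ , subst (λ z → ⟦ S ⟧ ≐ ⟦ T ⟧ ∪ ｛ z ｝) m≡F (∖-edge m∈S T≐)
    where
    T∈ : T ∈ 𝒩ᵣ r a b X
    T∈ = 𝒩-resp-≐ a b (≐-sym T≐) ∖∈𝒩 , S⊆ ∘ proj₁ ∘ proj₁ T≐

    -- `F` is computed from a list of gaps; uniqueness of the Frobenius number identifies its value
    -- with `m`.
    m≡F : + m ≡ FV (T , T∈)
    m≡F = frobenius-cong (∖-isFrobeniusNumber (FV-isF w) F<m T≐) (FV-isF (T , T∈))
            ((λ z → z) , (λ z → z))

proposition4p11 : (r n : ℕ) → 1 ≤ n →
    (a b : Vector ℕ n) (a>0 : All (0 <_) a) → All (0 <_) b →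
    (X : Pred ℕ 0ℓ) → Satisfiable X → (X⊆ : X ⊆ ｛ suc r ,→｝) →
    let open Graph (G r a b X a>0 X⊆) in
    IsTreeWithRoot (｛0, suc r ,→｝ , half-line∈𝒩ᵣ r a b X a>0 X⊆)
    × (∀ S (S∈@((isNS , _) , _) : S ∈ 𝒩ᵣ r a b X) →
    (λ T → ∃ λ (T∈ : T ∈ 𝒩ᵣ r a b X) → (T , T∈) IsChildOf (S , S∈))
    ≐
    (λ T → ∃ λ m → m ∈ msg S × F isNS ℤ.< + m × S ∖ ｛ m ｝ ∈ 𝒩 a b X
    × T ≐ S ∖ ｛ m ｝))
proposition4p11 r n _ a b a>0 b>0 X _ X⊆ =
  isTree r a b X a>0 X⊆ b>0 ,
  λ S S∈ →
    (λ { {T} (T∈ , e) → child⇒∖ r a b X a>0 X⊆ (T , T∈) (S , S∈) e }) ,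
    (λ { (m , m∈msg , F<m , ∖∈𝒩 , T≐) →
         ∖⇒child r a b X a>0 X⊆ (S , S∈) m∈msg F<m ∖∈𝒩 T≐ })
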